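{- For every positive integer $\gamma$ we have $\Xi(\gamma)\le 4\gamma$. Equivalently, every finite simple connected bridgeless graph $G$ has a strongly connected orientation of diameter at most $4\gamma(G)$.
   Context: All graphs are finite, simple and undirected. A graph is bridgeless connected if it is connected and stays connected after deleting any single edge. An orientation of $G$ assigns a direction to every edge; it is strongly connected if every vertex reaches every other vertex by a directed path. For a strongly connected digraph $H$, $d_H(u,v)$ is the number of arcs of a shortest directed path from $u$ to $v$, and $diam(H)=\max_{u,v}d_H(u,v)$. For a bridgeless connected graph $G$, $\overset{\longrightarrow}{diam}_{min}(G)$ is the minimum of $diam(H)$ over all strongly connected orientations $H$ of $G$. A dominating set of $G$ is a set $D\subseteq V(G)$ such that every vertex outside $D$ has a neighbor in $D$; $\gamma(G)$ denotes the minimum cardinality of a dominating set of $G$. For a positive integer $\gamma$, $\Xi(\gamma)=\max\{\overset{\longrightarrow}{diam}_{min}(G): G \text{ bridgeless connected}, \gamma(G)\le\gamma\}$. -}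

module Defs where

open import Data.Nat using (ℕ; zero; suc; _≤_)
open import Data.Fin using (Fin)
open import Data.Fin.Subset using (Subset; _∈_; _∉_)
open import Data.Bool using (Bool; true; false)
open import Data.Product using (Σ; ∃; _×_; _,_)
open import Data.Sum using (_⊎_)
open import Relation.Nullary using (¬_)
open import Relation.Binary.PropositionalEquality using (_≡_)

record Graph (n : ℕ) : Set where
  field
    adj   : Fin n → Fin n → Bool
    sym   : ∀ u v → adj u v ≡ adj v u
    irref : ∀ v → adj v v ≡ false

open Graph public

Edge : ∀ {n} → Graph n → Fin n → Fin n → Set
Edge G u v = adj G u v ≡ true

data Walk {n : ℕ} (R : Fin n → Fin n → Set) : Fin n → Fin n → ℕ → Set where
  here : ∀ {v} → Walk R v v zero
  step : ∀ {u w v k} → R u w → Walk R w v k → Walk R u v (suc k)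

AllReach : ∀ {n} → (Fin n → Fin n → Set) → Set
AllReach {n} R = ∀ (u v : Fin n) → ∃ λ k → Walk R u v k

Connected : ∀ {n} → Graph n → Set
Connected G = AllReach (Edge G)

EdgeWithout : ∀ {n} → Graph n → Fin n → Fin n → Fin n → Fin n → Set
EdgeWithout G a b u v = Edge G u v × ¬ ((u ≡ a × v ≡ b) ⊎ (u ≡ b × v ≡ a))

BridgelessConnected : ∀ {n} → Graph n → Set
BridgelessConnected {n} G =
  Connected G × (∀ (a b : Fin n) → Edge G a b → AllReach (EdgeWithout G a b))

record Orientation {n : ℕ} (G : Graph n) : Set where
  field
    arc      : Fin n → Fin n → Bool
    arc⇒edge : ∀ u v → arc u v ≡ true → Edge G u v
    edge⇒arc : ∀ u v → Edge G u v → (arc u v ≡ true) ⊎ (arc v u ≡ true)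
    one-dir  : ∀ u v → arc u v ≡ true → arc v u ≡ false

open Orientation public

Arc : ∀ {n} {G : Graph n} → Orientation G → Fin n → Fin n → Set
Arc O u v = arc O u v ≡ true

StronglyConnected : ∀ {n} {G : Graph n} → Orientation G → Set
StronglyConnected O = AllReach (Arc O)

-- diam(H) ≤ d : d_H(u,v) ≤ d for all u v (shortest directed walk = shortest directed path)
DiamAtMost : ∀ {n} {G : Graph n} → Orientation G → ℕ → Set
DiamAtMost {n} O d = ∀ (u v : Fin n) → ∃ λ k → k ≤ d × Walk (Arc O) u v k

Dominating : ∀ {n} → Graph n → Subset n → Set
Dominating {n} G D = ∀ (v : Fin n) → v ∉ D → ∃ λ u → u ∈ D × Edge G u v

{-# OPTIONS --safe #-}
module Submission where

-- A strongly oriented part H, grown from a single dominator by adding directed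
-- ears, carries the potential Φ H, in which a dominator counts 4 if it lies in H
-- and 1 if it is only adjacent to H. Dominators in H stay within Φ H − 4 of each
-- other, and other vertices pay up to 2 extra for being left and for being
-- entered, but one of the two costs them only 1. An ear is found by cutting the
-- loops from a walk that avoids its first edge, at the level of the stars of
-- dominators rather than of vertices. Inside each star that is new the ear either
-- makes the detour through the centre (three new vertices, Φ gains 4) or touches a
-- single leaf (one new vertex, Φ gains 1), and where it meets a star already
-- touched it picks up the centre (two new vertices, Φ gains 3). Reversing the
-- orientation when necessary, these gains pay for the longer distances. When H is
-- everything, Φ H = 4γ.

open import Defs
open import Algebra.Properties.CommutativeMonoid.Sum using ()
open import Data.Bool using (true)
open import Data.Bool.Properties using () renaming (_≟_ to _≟ᵇ_)
open import Data.Empty using (⊥)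
open import Data.Fin as Fin using (Fin; zero; suc)
open import Data.Fin.Properties using (_≟_; _<?_; <-asym; <-cmp; all?; ¬∀⟶∃¬)
open import Data.Fin.Subset using (Subset; inside; outside; ∣_∣) renaming (_∈_ to _∈ₛ_; _∉_ to _∉ₛ_)
open import Data.Fin.Subset.Properties using (drop-there) renaming (_∈?_ to _∈ₛ?_)
open import Data.List using (List; []; _∷_; _++_; length; map)
open import Data.List.Membership.DecPropositional using ()
open import Data.List.Membership.Propositional using (_∈_; _∉_; find; lose)
open import Data.List.Membership.Propositional.Properties using (∈-map⁺; ∈-map⁻; ∈-++⁺ˡ; ∈-++⁺ʳ; ∈-++⁻)
open import Data.List.Relation.Unary.All as All using (All; []; _∷_)
open import Data.List.Relation.Unary.All.Properties using (All¬⇒¬Any; ¬Any⇒All¬)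
open import Data.List.Relation.Unary.AllPairs using ([]; _∷_)
open import Data.List.Relation.Unary.Any as Any using (Any; here; there)
open import Data.List.Relation.Unary.Unique.Propositional using (Unique)
open import Data.Nat using (ℕ; zero; suc; _+_; _*_; _≤_; _<_; z≤n; s≤s; _≤?_)
open import Data.Nat.Induction using (<-wellFounded)
open import Data.Nat.Properties using
  ( ≤-refl; ≤-reflexive; ≤-trans; +-assoc; +-comm; +-identityʳ; +-mono-≤
  ; +-monoˡ-≤; +-monoʳ-≤; +-cancelʳ-≤; *-suc; m≤m+n; m≤n+m; +-0-commutativeMonoid )
open import Data.Nat.Tactic.RingSolver using (solve-∀)
open import Data.Product using (Σ; ∃; ∃₂; _×_; _,_; proj₁; proj₂)
open import Data.Product.Properties using (≡-dec)
open import Data.Sum as Sum using (_⊎_; inj₁; inj₂)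
open import Data.Unit using (⊤; tt)
open import Data.Vec as Vec using ()
open import Function using (_∘_)
open import Induction.WellFounded using (Acc; acc)
open import Relation.Binary.Definitions using (Decidable; tri<; tri≈; tri>)
open import Relation.Binary.PropositionalEquality as ≡ using (_≡_; _≢_; refl; cong; subst)
open import Relation.Nullary using (¬_; Dec; yes; no; does; contradiction; ¬?)
open import Relation.Nullary.Decidable using (True; toWitness; _⊎-dec_; _×-dec_; dec-true; dec-false; decidable-stable)
open Algebra.Properties.CommutativeMonoid.Sum +-0-commutativeMonoid using (sum)

-- Arithmetic and walks.

-- A linear combination a ≤ b of the hypotheses proves x ≤ y when x − y = a − b.
certify : ∀ {a b x y} → a ≤ b → x + b ≡ y + a → x ≤ y
certify {a} {b} {x} {y} a≤b eq = +-cancelʳ-≤ b x y (≤-trans (≤-reflexive eq) (+-monoʳ-≤ y a≤b))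

_⊞_ : ∀ {a b c d} → a ≤ b → c ≤ d → a + c ≤ b + d
_⊞_ = +-mono-≤
infixl 6 _⊞_

_▷_ : ∀ {n} {R : Fin n → Fin n → Set} {u v w j k} →
      Walk R u v j → Walk R v w k → Walk R u w (j + k)
here     ▷ q = q
step r p ▷ q = step r (p ▷ q)
infixr 5 _▷_

walk-map : ∀ {n} {R S : Fin n → Fin n → Set} → (∀ {u v} → R u v → S u v) →
           ∀ {u v k} → Walk R u v k → Walk S u v k
walk-map f here       = here
walk-map f (step r p) = step (f r) (walk-map f p)

snoc : ∀ {n} {R : Fin n → Fin n → Set} {u v w k} →
       Walk R u v k → R v w → Walk R u w (suc k)
snoc here       e = step e here
snoc (step r p) e = step r (snoc p e)

walk-reverse : ∀ {n} {R S : Fin n → Fin n → Set} → (∀ {u v} → R u v → S v u) →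
               ∀ {u v k} → Walk R u v k → Walk S v u k
walk-reverse f here       = here
walk-reverse f (step r p) = snoc (walk-reverse f p) (f r)

-- Weights of vertices.

-- A vertex is free of charge (dom), or pays one unit for being entered and two
-- for being left (inn), or two for being entered and one for being left (out).
data Kind : Set where
  dom inn out : Kind

iw ow : Kind → ℕ
iw dom = 0
iw inn = 1
iw out = 2
ow dom = 0
ow inn = 2
ow out = 1

flip : Kind → Kind
flip dom = dom
flip inn = out
flip out = inn

iw-flip : ∀ κ → iw (flip κ) ≡ ow κ
iw-flip dom = refl
iw-flip inn = refl
iw-flip out = refl

ow-flip : ∀ κ → ow (flip κ) ≡ iw κ
ow-flip dom = refl
ow-flip inn = refl
ow-flip out = refl

iw≤2 : ∀ κ → iw κ ≤ 2
iw≤2 dom = z≤n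
iw≤2 inn = s≤s z≤n
iw≤2 out = ≤-refl

ow≤2 : ∀ κ → ow κ ≤ 2
ow≤2 dom = z≤n
ow≤2 inn = ≤-refl
ow≤2 out = s≤s z≤n

iw≤1⊎ow≤1 : ∀ κ → iw κ ≤ 1 ⊎ ow κ ≤ 1
iw≤1⊎ow≤1 dom = inj₁ z≤n
iw≤1⊎ow≤1 inn = inj₁ ≤-refl
iw≤1⊎ow≤1 out = inj₂ ≤-refl

-- Distance bounds along an ear.

module _ {n : ℕ} where

  V : Set
  V = Fin n

  Links : (V → V → Set) → V → List (V × Kind) → V → Set
  Links R p []             t = R p t
  Links R p ((w , _) ∷ ws) t = R p w × Links R w ws t

  -- The way from `w′` back to `w` runs on to `t`, through the old part from `t` to `p`, and along
  -- the ear to `w`. The middle leg is at most the old potential minus 4, plus `oh + a`, whence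
  -- these two terms in `around≤`.
  record Before (R : V → V → Set) (p t : V) (a g oh : ℕ) (w w′ : V) (κ κ′ : Kind) : Set where
    constructor before
    field
      {kᵢ kₒ kₘ} : ℕ
      forth   : Walk R w w′ kₘ
      forth≤  : kₘ ≤ g + ow κ + iw κ′
      enter   : Walk R p w kᵢ
      leave   : Walk R w′ t kₒ
      around≤ : kᵢ + kₒ + a + oh ≤ g + iw κ + ow κ′

  -- The ear p → ws → t raises the potential by g. Here a and oh are the weights paid
  -- for entering p and leaving t: the bounds say that after the raise the ear
  -- keeps the distance invariant.
  record Bounds (R : V → V → Set) (p : V) (ws : List (V × Kind)) (t : V) (a g L oh : ℕ) : Set where
    field
      enter : ∀ {w κ} → (w , κ) ∈ ws → ∃ λ k → Walk R p w k × k + a ≤ g + iw κ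
      leave : ∀ {w κ} → (w , κ) ∈ ws → ∃ λ k → Walk R w t k × k + oh ≤ g + ow κ
      cross : ∃ λ k → Walk R p t k × k + oh ≤ L
      order : ∀ {w κ w′ κ′} → (w , κ) ∈ ws → (w′ , κ′) ∈ ws →
              w ≡ w′ ⊎ Before R p t a g oh w w′ κ κ′ ⊎ Before R p t a g oh w′ w κ′ κ

  bounds-[] : ∀ {R p t a L oh} → R p t → 1 + oh ≤ L → Bounds R p [] t a 0 L oh
  bounds-[] r h = record
    { enter = λ () ; leave = λ () ; cross = 1 , step r here , h ; order = λ () }

  -- Once `w` is put in front, `a` is only a notional weight of `w` as the start of the tail. The
  -- five inequalities serve, in turn, the later vertices, entering `w`, leaving `w`, crossing, and
  -- monotonicity of the gain. The second contains `g` because a later vertex that reaches `w`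
  -- around the ear may have spent `g` on its way to `t`.
  bounds-∷ : ∀ {R p w κ ws t a g L oh a′ g′ L′} → R p w → Bounds R w ws t a g L oh →
             1 + a′ + g ≤ a + g′ → 1 + a′ + g ≤ iw κ + g′ → L ≤ ow κ + g′ → 1 + L ≤ L′ → g ≤ g′ →
             Bounds R p ((w , κ) ∷ ws) t a′ g′ L′ oh
  bounds-∷ {R} {p} {v} {κ₀} {ws} {t} {a} {g} {L} {oh} {a′} {g′} {L′} r b h₁ h₂ h₃ h₄ h₅ = record
    { enter = enter′ ; leave = leave′ ; cross = cross′ ; order = order′ }
    where
    open Bounds b
    Q : V → V → Kind → Kind → Set
    Q = Before R p t a′ g′ oh
    enter′ : ∀ {w κ} → (w , κ) ∈ (v , κ₀) ∷ ws → ∃ λ k → Walk R p w k × k + a′ ≤ g′ + iw κ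
    enter′ (here refl) = 1 , step r here , ≤-trans (m≤m+n (1 + a′) g) (≤-trans h₂ (≤-reflexive (+-comm (iw κ₀) g′)))
    enter′ {κ = κ} (there i) with enter i
    ... | k , p , k≤ = suc k , step r p , certify (h₁ ⊞ k≤) (eq k a a′ g g′ (iw κ))
      where
      eq : ∀ k a a′ g g′ i → suc k + a′ + (a + g′ + (g + i)) ≡ g′ + i + (1 + a′ + g + (k + a))
      eq = solve-∀
    leave′ : ∀ {w κ} → (w , κ) ∈ (v , κ₀) ∷ ws → ∃ λ k → Walk R w t k × k + oh ≤ g′ + ow κ
    leave′ (here refl) with cross
    ... | k , p , k≤ = k , p , ≤-trans k≤ (≤-trans h₃ (≤-reflexive (+-comm (ow κ₀) g′)))
    leave′ {κ = κ} (there i) with leave i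
    ... | k , p , k≤ = k , p , ≤-trans k≤ (+-monoˡ-≤ (ow κ) h₅)
    cross′ : ∃ λ k → Walk R p t k × k + oh ≤ L′
    cross′ with cross
    ... | k , p , k≤ = suc k , step r p , ≤-trans (s≤s k≤) h₄
    head-first : ∀ {w κ} → (w , κ) ∈ ws → Q v w κ₀ κ
    head-first {κ = κ} i with enter i | leave i
    ... | k , p , k≤ | j , q , j≤ = before p (≤-trans (m≤m+n k a) (≤-trans k≤ (+-monoˡ-≤ (iw κ) (≤-trans h₅ (m≤m+n g′ (ow κ₀))))))
      (step r here) q (certify (h₂ ⊞ j≤) (eq j a′ oh g g′ (iw κ₀) (ow κ)))
      where
      eq : ∀ j a′ oh g g′ i o → 1 + j + a′ + oh + (i + g′ + (g + o)) ≡ g′ + i + o + (1 + a′ + g + (j + oh))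
      eq = solve-∀
    lift : ∀ {w w′ κ κ′} → Before R v t a g oh w w′ κ κ′ → Q w w′ κ κ′
    lift {κ = κ} {κ′} (before {kᵢ} {kₒ} m m≤ p q c≤) =
      before m (≤-trans m≤ (+-monoˡ-≤ (iw κ′) (+-monoˡ-≤ (ow κ) h₅))) (step r p) q
        (certify (h₁ ⊞ c≤) (eq kᵢ kₒ a a′ oh g g′ (iw κ) (ow κ′)))
      where
      eq : ∀ k j a a′ oh g g′ i o → suc k + j + a′ + oh + (a + g′ + (g + i + o)) ≡ g′ + i + o + (1 + a′ + g + (k + j + a + oh))
      eq = solve-∀
    order′ : ∀ {w κ w′ κ′} → (w , κ) ∈ (v , κ₀) ∷ ws → (w′ , κ′) ∈ (v , κ₀) ∷ ws → w ≡ w′ ⊎ Q w w′ κ κ′ ⊎ Q w′ w κ′ κ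
    order′ (here refl) (here refl) = inj₁ refl
    order′ (here refl) (there j)   = inj₂ (inj₁ (head-first j))
    order′ (there i)   (here refl) = inj₂ (inj₂ (head-first i))
    order′ (there i)   (there j)   with order i j
    ... | inj₁ e        = inj₁ e
    ... | inj₂ (inj₁ x) = inj₂ (inj₁ (lift x))
    ... | inj₂ (inj₂ x) = inj₂ (inj₂ (lift x))

-- Sums raised at distinct indices.

infixl 6 _[_]+=_
_[_]+=_ : ∀ {n} → (Fin n → ℕ) → Fin n → ℕ → Fin n → ℕ
(f [ zero  ]+= γ) zero    = f zero + γ
(f [ zero  ]+= γ) (suc v) = f (suc v)
(f [ suc ℓ ]+= γ) zero    = f zero
(f [ suc ℓ ]+= γ) (suc v) = ((f ∘ suc) [ ℓ ]+= γ) v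

sum-mono : ∀ {n} {f g : Fin n → ℕ} → (∀ v → f v ≤ g v) → sum f ≤ sum g
sum-mono {zero}  h = z≤n
sum-mono {suc n} h = +-mono-≤ (h zero) (sum-mono (h ∘ suc))

sum-+= : ∀ {n} (f : Fin n → ℕ) ℓ γ → sum (f [ ℓ ]+= γ) ≡ sum f + γ
sum-+= f zero    γ = eq (f zero) γ (sum (f ∘ suc))
  where
  eq : ∀ a b c → a + b + c ≡ a + c + b
  eq = solve-∀
sum-+= f (suc ℓ) γ = ≡.trans (cong (f zero +_) (sum-+= (f ∘ suc) ℓ γ)) (≡.sym (+-assoc (f zero) _ γ))

+=-same : ∀ {n} (f : Fin n → ℕ) ℓ γ → (f [ ℓ ]+= γ) ℓ ≡ f ℓ + γ
+=-same f zero    γ = refl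
+=-same f (suc ℓ) γ = +=-same (f ∘ suc) ℓ γ

+=-other : ∀ {n} (f : Fin n → ℕ) {ℓ v} γ → ℓ ≢ v → (f [ ℓ ]+= γ) v ≡ f v
+=-other f {zero}  {zero}  γ ne = contradiction refl ne
+=-other f {zero}  {suc v} γ ne = refl
+=-other f {suc ℓ} {zero}  γ ne = refl
+=-other f {suc ℓ} {suc v} γ ne = +=-other (f ∘ suc) γ (ne ∘ cong suc)

total : ∀ {n} → List (Fin n × ℕ) → ℕ
total []             = 0
total ((_ , γ) ∷ gs) = γ + total gs

-- The first gain is absorbed into `f`; as the indices are distinct, `f` stays the same at all the
-- others, and their gains remain available to the induction.
sum-gains : ∀ {n} (f f′ : Fin n → ℕ) gs → Unique (map proj₁ gs) → (∀ v → f v ≤ f′ v) →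
            All (λ (ℓ , γ) → f ℓ + γ ≤ f′ ℓ) gs → sum f + total gs ≤ sum f′
sum-gains f f′ [] u f≤f′ [] = ≤-trans (≤-reflexive (+-identityʳ _)) (sum-mono f≤f′)
sum-gains f f′ ((ℓ , γ) ∷ gs) (ℓ∉ ∷ u) f≤f′ (γ≤ ∷ h) =
  ≤-trans (≤-reflexive (≡.trans (≡.sym (+-assoc (sum f) γ _)) (cong (_+ total gs) (≡.sym (sum-+= f ℓ γ)))))
    (sum-gains (f [ ℓ ]+= γ) f′ gs u raised (rest gs ℓ∉ h))
  where
  raised : ∀ v → (f [ ℓ ]+= γ) v ≤ f′ v
  raised v with ℓ ≟ v
  ... | yes refl = ≤-trans (≤-reflexive (+=-same f ℓ γ)) γ≤
  ... | no ℓ≢v   = ≤-trans (≤-reflexive (+=-other f γ ℓ≢v)) (f≤f′ v)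
  rest : ∀ gs → All (ℓ ≢_) (map proj₁ gs) → All (λ (m , γ′) → f m + γ′ ≤ f′ m) gs →
         All (λ (m , γ′) → (f [ ℓ ]+= γ) m + γ′ ≤ f′ m) gs
  rest [] [] [] = []
  rest ((m , γ′) ∷ gs) (ne ∷ nes) (h ∷ hs) =
    subst (λ z → z + γ′ ≤ f′ m) (≡.sym (+=-other f γ ne)) h ∷ rest gs nes hs

+-num : ∀ i j g {_ : True (i ≤? j)} → i + g ≤ j + g
+-num i j g {i≤j} = +-monoˡ-≤ g (toWitness i≤j)

-- The potential.

module Potential {n : ℕ} (G : Graph n) (D : Subset n) where

  open Data.List.Membership.DecPropositional (_≟_ {n}) using (_∈?_)

  symE : ∀ {u v} → Edge G u v → Edge G v u
  symE {u} {v} e = ≡.trans (Graph.sym G v u) e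

  Touches : List (Fin n) → Fin n → Set
  Touches H v = Any (λ u → Edge G u v) H

  touches? : ∀ H v → Dec (Touches H v)
  touches? H v = Any.any? (λ u → adj G u v ≟ᵇ true) H

  φ : List (Fin n) → Fin n → ℕ
  φ H d with d ∈ₛ? D | d ∈? H | touches? H d
  ... | no _  | _     | _     = 0
  ... | yes _ | yes _ | _     = 4
  ... | yes _ | no _  | yes _ = 1
  ... | yes _ | no _  | no _  = 0

  Φ : List (Fin n) → ℕ
  Φ H = sum (φ H)

  φ-in : ∀ {H d} → d ∈ₛ D → d ∈ H → φ H d ≡ 4
  φ-in {H} {d} d∈D d∈H with d ∈ₛ? D | d ∈? H | touches? H d
  ... | no d∉D | _     | _ = contradiction d∈D d∉D
  ... | yes _  | yes _ | _ = refl
  ... | yes _  | no d∉H | _ = contradiction d∈H d∉H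

  φ-∉D : ∀ {H d} → d ∉ₛ D → φ H d ≡ 0
  φ-∉D {H} {d} d∉D with d ∈ₛ? D | d ∈? H | touches? H d
  ... | no _    | _ | _ = refl
  ... | yes d∈D | _ | _ = contradiction d∈D d∉D

  φ≤4 : ∀ H d → φ H d ≤ 4
  φ≤4 H d with d ∈ₛ? D | d ∈? H | touches? H d
  ... | no _  | _     | _     = z≤n
  ... | yes _ | yes _ | _     = ≤-refl
  ... | yes _ | no _  | yes _ = s≤s z≤n
  ... | yes _ | no _  | no _  = z≤n

  φ-touched : ∀ {H d} → d ∈ₛ D → Touches H d → 1 ≤ φ H d
  φ-touched {H} {d} d∈D τ with d ∈ₛ? D | d ∈? H | touches? H d
  ... | no d∉D | _     | _     = contradiction d∈D d∉D
  ... | yes _  | yes _ | _     = s≤s z≤n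
  ... | yes _  | no _  | yes _ = s≤s z≤n
  ... | yes _  | no _  | no ¬τ = contradiction τ ¬τ

  φ-untouched : ∀ {H d} → d ∉ H → ¬ Touches H d → φ H d ≡ 0
  φ-untouched {H} {d} d∉H ¬τ with d ∈ₛ? D | d ∈? H | touches? H d
  ... | no _  | _       | _     = refl
  ... | yes _ | yes d∈H | _     = contradiction d∈H d∉H
  ... | yes _ | no _    | yes τ = contradiction τ ¬τ
  ... | yes _ | no _    | no _  = refl

  φ-out : ∀ {H d} → d ∉ H → φ H d ≤ 1
  φ-out {H} {d} d∉H with d ∈ₛ? D | d ∈? H | touches? H d
  ... | no _  | _       | _     = z≤n
  ... | yes _ | yes d∈H | _     = contradiction d∈H d∉H
  ... | yes _ | no _    | yes _ = ≤-refl
  ... | yes _ | no _    | no _  = z≤n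

  φ-mono : ∀ {H H′} → (∀ {v} → v ∈ H → v ∈ H′) → ∀ d → φ H d ≤ φ H′ d
  φ-mono {H} {H′} H⊆ d with d ∈ₛ? D | d ∈? H | touches? H d | d ∈? H′ | touches? H′ d
  ... | no _  | _       | _     | _       | _     = z≤n
  ... | yes _ | yes d∈H | _     | yes _   | _     = ≤-refl
  ... | yes _ | yes d∈H | _     | no d∉H′ | _     = contradiction (H⊆ d∈H) d∉H′
  ... | yes _ | no _    | yes _ | yes _   | _     = s≤s z≤n
  ... | yes _ | no _    | yes _ | no _    | yes _ = ≤-refl
  ... | yes _ | no _    | yes τ | no _    | no ¬τ = contradiction (let (u , u∈ , e) = find τ in lose (H⊆ u∈) e) ¬τ
  ... | yes _ | no _    | no _  | _       | _     = z≤n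

sum≤4*∣D∣ : ∀ {n} (D : Subset n) (f : Fin n → ℕ) → (∀ v → v ∉ₛ D → f v ≡ 0) → (∀ v → f v ≤ 4) →
              sum f ≤ 4 * ∣ D ∣
sum≤4*∣D∣ {zero}  Vec.[]            f h₀ h₄ = z≤n
sum≤4*∣D∣ {suc n} (outside Vec.∷ D) f h₀ h₄ rewrite h₀ zero (λ ()) =
  sum≤4*∣D∣ D (f ∘ suc) (λ v v∉D → h₀ (suc v) (v∉D ∘ drop-there)) (h₄ ∘ suc)
sum≤4*∣D∣ {suc n} (inside Vec.∷ D)  f h₀ h₄ rewrite *-suc 4 ∣ D ∣ =
  +-mono-≤ (h₄ zero) (sum≤4*∣D∣ D (f ∘ suc) (λ v v∉D → h₀ (suc v) (v∉D ∘ drop-there)) (h₄ ∘ suc))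

-- Stars of dominators and paths through them.

module Ears {n : ℕ} (G : Graph n) (D : Subset n) (dominating : Dominating G D) (H : List (Fin n)) where

  open Data.List.Membership.DecPropositional (_≟_ {n}) using (_∈?_)
  open Potential G D

  -- Partitions the vertices outside H into stars around dominators outside H;
  -- a vertex whose chosen dominator lies in H forms a star of its own.
  label : Fin n → Fin n
  label w with w ∈ₛ? D
  ... | yes _ = w
  ... | no w∉D with dominating w w∉D
  ...   | d , _ with d ∈? H
  ...     | yes _ = w
  ...     | no _  = d

  data Label (w : Fin n) : Fin n → Set where
    self  : w ∈ₛ D → Label w w
    lone  : ∀ {h} → w ∉ₛ D → h ∈ₛ D → h ∈ H → Edge G h w → Label w w
    under : ∀ {d} → w ∉ₛ D → d ∈ₛ D → d ∉ H → Edge G d w → Label w d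

  labelled : ∀ w → Label w (label w)
  labelled w with w ∈ₛ? D
  ... | yes w∈D = self w∈D
  ... | no w∉D with dominating w w∉D
  ...   | d , d∈D , e with d ∈? H
  ...     | yes d∈H = lone w∉D d∈D d∈H e
  ...     | no d∉H  = under w∉D d∈D d∉H e

  label-self : ∀ {d} → d ∈ₛ D → label d ≡ d
  label-self {d} d∈D with d ∈ₛ? D
  ... | yes _   = refl
  ... | no d∉D = contradiction d∈D d∉D

  -- Marks the stars from which an ear can return to `H` by way of a dominator: a label outside `D`
  -- belongs to a `lone` vertex, whose dominator lies in `H`, and otherwise the centre itself has a
  -- neighbour in `H`.
  Grounded : Fin n → Set
  Grounded ℓ = ℓ ∉ₛ D ⊎ Touches H ℓ

  grounded? : ∀ ℓ → Dec (Grounded ℓ)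
  grounded? ℓ = ¬? (ℓ ∈ₛ? D) ⊎-dec touches? H ℓ

  ungrounded : ∀ {ℓ} → ¬ Grounded ℓ → ℓ ∈ₛ D × ¬ Touches H ℓ
  ungrounded {ℓ} ¬γ = decidable-stable (ℓ ∈ₛ? D) (¬γ ∘ inj₁) , ¬γ ∘ inj₂

  Fresh : List (Fin n) → Fin n × Kind → Set
  Fresh ls (w , _) = w ∉ H × label w ∈ ls

  -- `bounds` ranges over all relations that contain the arcs of the path, since the enlarged
  -- orientation in which distances are measured is formed only after the ear is complete.
  record Path (ls : List (Fin n)) (p : Fin n) (ws : List (Fin n × Kind)) (t : Fin n)
              (a g L oh : ℕ) : Set₁ where
    field
      edges  : Links (Edge G) p ws t
      fresh  : All (Fresh ls) ws
      unique : Unique (map proj₁ ws)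
      doms   : All (λ (w , κ) → w ∈ₛ D → κ ≡ dom) ws
      bounds : ∀ {R} → Links R p ws t → Bounds R p ws t a g L oh

  path-[] : ∀ {p t a L oh} → Edge G p t → 1 + oh ≤ L → Path [] p [] t a 0 L oh
  path-[] e h = record
    { edges = e ; fresh = [] ; unique = [] ; doms = [] ; bounds = λ r → bounds-[] r h }

  path-label : ∀ {ℓ ls p ws t a g L oh} → Path ls p ws t a g L oh → Path (ℓ ∷ ls) p ws t a g L oh
  path-label P = record
    { edges = edges ; unique = unique ; doms = doms ; bounds = bounds
    ; fresh = All.map (λ (w∉H , i) → w∉H , there i) fresh }
    where open Path P

  ∉-path : ∀ {ls p ws t a g L oh w} → Path ls p ws t a g L oh → label w ∉ ls → w ∉ map proj₁ ws
  ∉-path P ∉ls i with ∈-map⁻ proj₁ i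
  ... | _ , j , refl = ∉ls (proj₂ (All.lookup (Path.fresh P) j))

  ∉-∷ : ∀ {w v : Fin n} {vs} → w ≢ v → w ∉ vs → w ∉ v ∷ vs
  ∉-∷ ne ∉vs (here e)  = ne e
  ∉-∷ ne ∉vs (there i) = ∉vs i

  path-∷ : ∀ {ls p w ws t a g L oh} κ a′ g′ {L′} → Edge G p w → w ∉ H → label w ∈ ls →
           w ∉ map proj₁ ws → (w ∈ₛ D → κ ≡ dom) →
           Path ls w ws t a g L oh →
           1 + a′ + g ≤ a + g′ → 1 + a′ + g ≤ iw κ + g′ → L ≤ ow κ + g′ → 1 + L ≤ L′ → g ≤ g′ →
           Path ls p ((w , κ) ∷ ws) t a′ g′ L′ oh
  path-∷ κ a′ g′ e w∉H w∈ls w∉ws d P h₁ h₂ h₃ h₄ h₅ = record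
    { edges = e , edges ; fresh = (w∉H , w∈ls) ∷ fresh ; unique = ¬Any⇒All¬ _ w∉ws ∷ unique
    ; doms = d ∷ doms ; bounds = λ (r , rs) → bounds-∷ r (bounds rs) h₁ h₂ h₃ h₄ h₅ }
    where open Path P

  -- Quantifying over every larger `H′` lets a recorded gain survive when the ear is prolonged.
  record Gains (ws : List (Fin n × Kind)) (ℓγ : Fin n × ℕ) : Set where
    constructor gains
    field
      gained : ∀ H′ → (∀ v → v ∈ H → v ∈ H′) → (∀ w → w ∈ map proj₁ ws → w ∈ H′) →
               φ H (proj₁ ℓγ) + proj₂ ℓγ ≤ φ H′ (proj₁ ℓγ)

  -- Passing through an untouched star.

  module _ (kind : Fin n → Kind) (a₀ w₀ : Fin n) where

    -- The weight a is charged for entering the ear at p. Once the gains are spent,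
    -- crossing the whole ear costs at most e units beyond its last arc.
    record Ear (p : Fin n) (ls : List (Fin n)) (a e : ℕ) : Set₁ where
      field
        {ws}   : List (Fin n × Kind)
        {t}    : Fin n
        gs     : List (Fin n × ℕ)
        t∈H    : t ∈ H
        names  : map proj₁ gs ≡ ls
        path   : Path ls p ws t a (total gs) (1 + e + total gs) (ow (kind t))
        nondeg : ws ≡ [] → EdgeWithout G a₀ w₀ p t
        earned : All (Gains ws) gs

    -- The ear has a new vertex, and `Q` is attached to the case of exactly one. There `Q` will say
    -- that the ear does not leave this vertex along the edge between `a₀` and `w₀`.
    Opens : ∀ {p ls a e} → Ear p ls a e → Set → Set
    Opens E Q = ∃₂ λ wκ ws′ → Ear.ws E ≡ wκ ∷ ws′ × (ws′ ≡ [] → Q)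

    gains-∷ : ∀ {ws wκ gs} → All (Gains ws) gs → All (Gains (wκ ∷ ws)) gs
    gains-∷ = All.map (λ (gains γ) → gains λ H′ H⊆ ws⊆ → γ H′ H⊆ (λ w → ws⊆ w ∘ there))

    data Member (ℓ w : Fin n) : Set where
      centre : w ≡ ℓ → Member ℓ w
      leaf   : w ∉ₛ D → Edge G ℓ w → Member ℓ w

    member : ∀ {ℓ w} → ℓ ∈ₛ D → label w ≡ ℓ → Member ℓ w
    member {w = w} ℓ∈D refl with label w | labelled w
    ... | _ | self _          = centre refl
    ... | _ | lone w∉D _ _ _  = contradiction ℓ∈D w∉D
    ... | _ | under w∉D _ _ e = leaf w∉D e

    centre∉H : ∀ {w} → label w ∈ₛ D → w ∉ H → label w ∉ H
    centre∉H {w} ℓ∈D w∉H with label w | labelled w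
    ... | _ | self _            = w∉H
    ... | _ | lone w∉D _ _ _    = w∉H
    ... | _ | under _ _ d∉H _ = d∉H

    -- Visits the untouched star of ℓ, entering at x and leaving at y.
    cluster : ∀ {p x y ℓ ls e} → e ≤ 2 → ℓ ∈ₛ D → ¬ Touches H ℓ → ℓ ∉ ls →
              Edge G p x → x ∉ H → label x ≡ ℓ → y ∉ H → label y ≡ ℓ → Ear y ls 1 e →
              Σ (Ear p (ℓ ∷ ls) 1 e) λ E → Opens E (x ≡ y × EdgeWithout G a₀ w₀ y (Ear.t E))
    cluster {p} {x} {y} {ℓ} {ls} {e} e≤2 ℓ∈D ¬τ ℓ∉ls p~x x∉H x∈ℓ y∉H y∈ℓ E =
      go (x ≟ y) (member ℓ∈D x∈ℓ) (member ℓ∈D y∈ℓ)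
      where
      open Ear E
      g : ℕ
      g = total gs
      L : ℕ
      L = 1 + e + g
      ℓ∉H : ℓ ∉ H
      ℓ∉H = subst (_∉ H) x∈ℓ (centre∉H (subst (_∈ₛ D) (≡.sym x∈ℓ) ℓ∈D) x∉H)
      P : Path (ℓ ∷ ls) y ws t 1 g L (ow (kind t))
      P = path-label path
      absent : ∀ {w} → label w ≡ ℓ → w ∉ map proj₁ ws
      absent w∈ℓ = ∉-path path (ℓ∉ls ∘ subst (_∈ ls) w∈ℓ)
      ≤g : ∀ j {_ : True (2 ≤? j)} → e + g ≤ j + g
      ≤g j {h} = +-monoˡ-≤ g (≤-trans e≤2 (toWitness h))
      gain₄ : ∀ {ws} → ℓ ∈ map proj₁ ws → Gains ws (ℓ , 4)
      gain₄ i = gains λ H′ H⊆ ws⊆ → ≤-reflexive (≡.trans (cong (_+ 4) (φ-untouched ℓ∉H ¬τ)) (≡.sym (φ-in ℓ∈D (ws⊆ _ i))))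
      Result : Set₁
      Result = Σ (Ear p (ℓ ∷ ls) 1 e) λ E → Opens E (x ≡ y × EdgeWithout G a₀ w₀ y (Ear.t E))
      ear : ∀ γ {wκ ws′} → Path (ℓ ∷ ls) p (wκ ∷ ws′) t 1 (γ + g) (γ + L) (ow (kind t)) →
            Gains (wκ ∷ ws′) (ℓ , γ) → All (Gains (wκ ∷ ws′)) gs →
            (ws′ ≡ [] → x ≡ y × ws ≡ []) → Result
      ear γ {wκ} {ws′} P γ≤ γs nd = record
        { gs = (ℓ , γ) ∷ gs ; t∈H = t∈H ; names = cong (ℓ ∷_) names
        ; path = subst (λ L → Path (ℓ ∷ ls) p (wκ ∷ ws′) t 1 (γ + g) L (ow (kind t))) (eq γ e g) P
        ; nondeg = λ () ; earned = γ≤ ∷ γs } , wκ , ws′ , refl , λ i → proj₁ (nd i) , nondeg (proj₂ (nd i))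
        where
        eq : ∀ γ e g → γ + (1 + e + g) ≡ 1 + e + (γ + g)
        eq = solve-∀
      go : Dec (x ≡ y) → Member ℓ x → Member ℓ y → Result
      go (yes refl) (centre refl) _ = ear 4
        (path-∷ dom 1 (4 + g) p~x x∉H (here x∈ℓ) (absent x∈ℓ) (λ _ → refl) P
          (+-num 2 5 g) (+-num 2 4 g) (s≤s (≤g 3)) (+-num 1 4 L) (+-num 0 4 g))
        (gain₄ (here refl)) (gains-∷ earned) (λ ws≡[] → refl , ws≡[])
      -- The centre merely becomes adjacent to the enlarged part. This unit and the leaving weight 2
      -- of `inn` pay for the crossing cost `1 + e` of the tail, which is where `e ≤ 2` is tight.
      go (yes refl) (leaf x∉D ℓ~x) _ = ear 1
        (path-∷ inn 1 (1 + g) p~x x∉H (here x∈ℓ) (absent x∈ℓ) (λ x∈D → contradiction x∈D x∉D) P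
          ≤-refl ≤-refl (s≤s (≤g 2)) ≤-refl (+-num 0 1 g))
        (gains λ H′ H⊆ ws⊆ → ≤-trans (≤-reflexive (cong (_+ 1) (φ-untouched ℓ∉H ¬τ)))
          (φ-touched ℓ∈D (lose (ws⊆ _ (here refl)) (symE ℓ~x))))
        (gains-∷ earned) (λ ws≡[] → refl , ws≡[])
      go (no x≢y) (centre refl) (centre refl) = contradiction refl x≢y
      go (no x≢y) (centre refl) (leaf y∉D ℓ~y) = ear 4
        (path-∷ dom 1 (4 + g) p~x x∉H (here x∈ℓ) (∉-∷ x≢y (absent x∈ℓ)) (λ _ → refl)
          (path-∷ inn 1 (1 + g) ℓ~y y∉H (here y∈ℓ) (absent y∈ℓ) (λ y∈D → contradiction y∈D y∉D) P
            ≤-refl ≤-refl (s≤s (≤g 2)) ≤-refl (+-num 0 1 g))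
          (+-num 3 5 g) (+-num 3 4 g) (s≤s (s≤s (≤g 2))) (+-num 2 4 L) (+-num 1 4 g))
        (gain₄ (here refl)) (gains-∷ (gains-∷ earned)) (λ ())
      go (no x≢y) (leaf x∉D ℓ~x) (centre refl) = ear 4
        (path-∷ out 1 (4 + g) p~x x∉H (here x∈ℓ) (∉-∷ x≢y (absent x∈ℓ)) (λ x∈D → contradiction x∈D x∉D)
          (path-∷ dom 2 (4 + g) (symE ℓ~x) y∉H (here y∈ℓ) (absent y∈ℓ) (λ _ → refl) P
            (+-num 3 5 g) (+-num 3 4 g) (s≤s (≤g 3)) ≤-refl (+-num 0 4 g))
          (+-num 6 6 g) (+-num 6 6 g) (s≤s (s≤s (≤g 3))) (+-num 2 4 L) ≤-refl)
        (gain₄ (there (here refl))) (gains-∷ (gains-∷ earned)) (λ ())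
      -- The detour is made even if `x` and `y` are adjacent. A leaf with an arc to its centre is
      -- `out`, one with an arc from it is `inn`. One unit of the gain is booked at `y` and the
      -- other three at the centre; the notional weight 2 is the entering weight of `x`.
      go (no x≢y) (leaf x∉D ℓ~x) (leaf y∉D ℓ~y) = ear 4
        (path-∷ out 1 (4 + g) p~x x∉H (here x∈ℓ) (∉-∷ x≢ℓ (∉-∷ x≢y (absent x∈ℓ))) (λ x∈D → contradiction x∈D x∉D)
          (path-∷ dom 2 (4 + g) (symE ℓ~x) ℓ∉H (here ℓ∈ℓ) (∉-∷ (λ { refl → y∉D ℓ∈D }) (absent ℓ∈ℓ)) (λ _ → refl)
            (path-∷ inn 1 (1 + g) ℓ~y y∉H (here y∈ℓ) (absent y∈ℓ) (λ y∈D → contradiction y∈D y∉D) P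
              ≤-refl ≤-refl (s≤s (≤g 2)) ≤-refl (+-num 0 1 g))
            (+-num 4 5 g) (+-num 4 4 g) (s≤s (s≤s (≤g 2))) ≤-refl (+-num 1 4 g))
          (+-num 6 6 g) (+-num 6 6 g) (s≤s (s≤s (s≤s (≤g 2)))) (+-num 3 4 L) ≤-refl)
        (gain₄ (there (here refl))) (gains-∷ (gains-∷ (gains-∷ earned))) (λ ())
        where
        x≢ℓ : x ≢ ℓ
        x≢ℓ refl = x∉D ℓ∈D
        ℓ∈ℓ : label ℓ ≡ ℓ
        ℓ∈ℓ = label-self ℓ∈D

    -- First and last stars of an ear.

    module _ (dom-kind : ∀ {h} → h ∈ H → h ∈ₛ D → kind h ≡ dom) where

      gain₃ : ∀ {ws ℓ} → ℓ ∈ₛ D → ℓ ∉ H → ℓ ∈ map proj₁ ws → Gains ws (ℓ , 3)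
      gain₃ ℓ∈D ℓ∉H i = gains λ H′ H⊆ ws⊆ →
        ≤-trans (+-monoˡ-≤ 3 (φ-out ℓ∉H)) (≤-reflexive (≡.sym (φ-in ℓ∈D (ws⊆ _ i))))

      gain₀ : ∀ {ws ℓ} → Gains ws (ℓ , 0)
      gain₀ {ℓ = ℓ} = gains λ H′ H⊆ ws⊆ →
        ≤-trans (≤-reflexive (+-identityʳ _)) (φ-mono (λ {v} → H⊆ v) ℓ)

      -- Either the dominator of `w` lies in `H` and costs nothing to leave, or the ear picks up the
      -- centre, whose potential rises from at most 1 to 4, and these 3 units pay for any leaving
      -- weight at the end.
      ground : ∀ {y w e} → 1 ≤ e → Edge G y w → w ∉ H → Grounded (label w) → Ear y (label w ∷ []) 1 e
      ground {y} {w} {e} 1≤e y~w w∉H γ = go (label w) refl (labelled w) γ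
        where
        go : ∀ ℓ → label w ≡ ℓ → Label w ℓ → Grounded ℓ → Ear y (ℓ ∷ []) 1 e
        go ℓ w∈ℓ (lone {h} w∉D h∈D h∈H h~w) _ = record
          { gs = (ℓ , 0) ∷ [] ; t∈H = h∈H ; names = refl ; nondeg = λ () ; earned = gain₀ ∷ []
          ; path = path-∷ out 1 0 y~w w∉H (here w∈ℓ) (λ ()) (λ w∈D → contradiction w∈D w∉D)
              (path-label (path-[] {a = 2} {L = 1} (symE h~w) (≤-reflexive (cong (suc ∘ ow) (dom-kind h∈H h∈D)))))
              ≤-refl ≤-refl ≤-refl (s≤s (≤-trans 1≤e (m≤m+n e 0))) z≤n }
        go ℓ w∈ℓ (self w∈D) (inj₁ w∉D) = contradiction w∈D w∉D
        go ℓ w∈ℓ (self w∈D) (inj₂ τ) with find τ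
        ... | u , u∈H , u~w = record
          { gs = (ℓ , 3) ∷ [] ; t∈H = u∈H ; names = refl ; nondeg = λ ()
          ; earned = gain₃ w∈D w∉H (here refl) ∷ []
          ; path = path-∷ dom 1 3 y~w w∉H (here w∈ℓ) (λ ()) (λ _ → refl)
              (path-label (path-[] {a = 2} {L = 3} (symE u~w) (s≤s (ow≤2 (kind u)))))
              (+-num 2 5 0) (+-num 2 3 0) ≤-refl (s≤s (m≤n+m 3 e)) z≤n }
        go ℓ w∈ℓ (under w∉D ℓ∈D ℓ∉H _) (inj₁ ℓ∉D) = contradiction ℓ∈D ℓ∉D
        go ℓ w∈ℓ (under w∉D ℓ∈D ℓ∉H ℓ~w) (inj₂ τ) with find τ
        ... | u , u∈H , u~ℓ = record
          { gs = (ℓ , 3) ∷ [] ; t∈H = u∈H ; names = refl ; nondeg = λ ()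
          ; earned = gain₃ ℓ∈D ℓ∉H (there (here refl)) ∷ []
          ; path = path-∷ out 1 3 y~w w∉H (here w∈ℓ) (∉-∷ (λ { refl → w∉D ℓ∈D }) (λ ())) (λ w∈D → contradiction w∈D w∉D)
              (path-∷ dom 2 3 (symE ℓ~w) ℓ∉H (here (label-self ℓ∈D)) (λ ()) (λ _ → refl)
                (path-label (path-[] {a = 2} {L = 3} (symE u~ℓ) (s≤s (ow≤2 (kind u)))))
                (+-num 3 5 0) (+-num 3 3 0) ≤-refl ≤-refl z≤n)
              (+-num 5 5 0) (+-num 5 5 0) ≤-refl (s≤s (+-monoˡ-≤ 3 1≤e)) ≤-refl }

      StartEar : Fin n → Fin n → List (Fin n) → Set₁
      StartEar s ℓ ls = Σ (Ear s (ℓ ∷ ls) (iw (kind s)) 2) λ E →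
                          Opens E (EdgeWithout G a₀ w₀ ℓ (Ear.t E))

      -- A dominator `s` has weight 0, so the entering weight 1 of `inn` pays for the first arc
      -- without any gain, and the leaving weight 2 pays for crossing a tail with excess 1.
      start-lone : ∀ {s ℓ ls} → s ∈ₛ D → s ∈ H → Edge G s ℓ → ℓ ∉ₛ D → ℓ ∉ H → label ℓ ≡ ℓ → ℓ ∉ ls →
                   Ear ℓ ls 1 1 → StartEar s ℓ ls
      start-lone {s} {ℓ} {ls} s∈D s∈H s~ℓ ℓ∉D ℓ∉H ℓ∈ℓ ℓ∉ls E rewrite dom-kind s∈H s∈D = record
        { gs = (ℓ , 0) ∷ gs ; t∈H = t∈H ; names = cong (ℓ ∷_) names ; nondeg = λ ()
        ; earned = gain₀ ∷ gains-∷ earned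
        ; path = path-∷ inn 0 g s~ℓ ℓ∉H (here ℓ∈ℓ) (∉-path path (ℓ∉ls ∘ subst (_∈ ls) ℓ∈ℓ))
            (λ ℓ∈D → contradiction ℓ∈D ℓ∉D) (path-label path) ≤-refl ≤-refl ≤-refl ≤-refl ≤-refl } ,
        _ , _ , refl , nondeg
        where
        open Ear E
        g : ℕ
        g = total gs

      -- One arc and an entering weight of up to 2 at `s` consume the gain of 3. A leaf `y` behind
      -- the centre brings no gain, and its leaving weight 2 just pays for crossing a tail with
      -- excess 1.
      start-centre : ∀ {s ℓ y ls} → Edge G s ℓ → ℓ ∈ₛ D → ℓ ∉ H → y ∉ H → label y ≡ ℓ → ℓ ∉ ls →
                     Ear y ls 1 1 → StartEar s ℓ ls
      start-centre {s} {ℓ} {y} {ls} s~ℓ ℓ∈D ℓ∉H y∉H y∈ℓ ℓ∉ls E = go (member ℓ∈D y∈ℓ)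
        where
        open Ear E
        g : ℕ
        g = total gs
        ∉ws : ∀ {w} → label w ≡ ℓ → w ∉ map proj₁ ws
        ∉ws w∈ℓ = ∉-path path (ℓ∉ls ∘ subst (_∈ ls) w∈ℓ)
        i≤ : ∀ {m} → iw (kind s) + m ≤ 2 + m
        i≤ {m} = +-monoˡ-≤ m (iw≤2 (kind s))
        go : Member ℓ y → StartEar s ℓ ls
        go (centre refl) = record
          { gs = (ℓ , 3) ∷ gs ; t∈H = t∈H ; names = cong (ℓ ∷_) names ; nondeg = λ ()
          ; earned = gain₃ ℓ∈D ℓ∉H (here refl) ∷ gains-∷ earned
          ; path = path-∷ dom _ (3 + g) s~ℓ ℓ∉H (here y∈ℓ) (∉ws y∈ℓ) (λ _ → refl) (path-label path)
              (s≤s (≤-trans i≤ (+-num 2 3 g))) (s≤s i≤) (+-num 2 3 g) (+-num 3 6 g) (+-num 0 3 g) } ,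
          _ , _ , refl , nondeg
        go (leaf y∉D ℓ~y) = record
          { gs = (ℓ , 3) ∷ gs ; t∈H = t∈H ; names = cong (ℓ ∷_) names ; nondeg = λ ()
          ; earned = gain₃ ℓ∈D ℓ∉H (here refl) ∷ gains-∷ (gains-∷ earned)
          ; path = path-∷ dom _ (3 + g) s~ℓ ℓ∉H (here (label-self ℓ∈D))
              (∉-∷ (λ { refl → y∉D ℓ∈D }) (∉ws (label-self ℓ∈D))) (λ _ → refl)
              (path-∷ inn 0 g ℓ~y y∉H (here y∈ℓ) (∉ws y∈ℓ) (λ y∈D → contradiction y∈D y∉D) (path-label path)
                ≤-refl ≤-refl ≤-refl ≤-refl ≤-refl)
              (s≤s i≤) (s≤s i≤) ≤-refl (+-num 4 6 g) (+-num 0 3 g) } ,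
          _ , _ , refl , λ ()

  -- Routes from star to star, with loops cut.

  module _ (a₀ w₀ ℓ₀ : Fin n) where

    -- The list holds the labels of the stars visited after leaving the first vertex. The ear
    -- is to start in the star ℓ₀, so while loops are being cut ℓ₀ is the only grounded
    -- star through which a route may pass.
    data Route : Fin n → List (Fin n) → Set where
      toH : ∀ {y t} → EdgeWithout G a₀ w₀ y t → t ∈ H → Route y []
      toG : ∀ {y w} → Edge G y w → w ∉ H → Grounded (label w) → label w ≢ ℓ₀ → Route y (label w ∷ [])
      via : ∀ {y x y′ ls} → Edge G y x → x ∉ H → y′ ∉ H → label y′ ≡ label x →
            (Grounded (label x) → label x ≡ ℓ₀) → label x ∉ ls → Route y′ ls → Route y (label x ∷ ls)

    route-unique : ∀ {y ls} → Route y ls → Unique ls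
    route-unique (toH _ _)               = []
    route-unique (toG _ _ _ _)           = [] ∷ []
    route-unique (via _ _ _ _ _ ∉ls r) = ¬Any⇒All¬ _ ∉ls ∷ route-unique r

    Exit : Fin n → Set
    Exit ℓ = ∃₂ λ y ls → y ∉ H × label y ≡ ℓ × ℓ ∉ ls × Route y ls

    -- The labels of a route are distinct, so whatever follows the visit to `ℓ` is an exit. The
    -- visit is not a final grounded star: that one differs from `ℓ₀`, whereas `ℓ` can be grounded
    -- only if it is `ℓ₀`.
    cut : ∀ {y ls ℓ} → Route y ls → ℓ ∈ ls → (Grounded ℓ → ℓ ≡ ℓ₀) → Exit ℓ
    cut (toG _ _ γ ≢ℓ₀) (here refl) free = contradiction (free γ) ≢ℓ₀
    cut (via _ _ y∉H y∈ℓ _ ∉ls r) (here refl) _ = _ , _ , y∉H , y∈ℓ , ∉ls , r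
    cut (via _ _ _ _ _ _ r) (there i) free = cut r i free

    -- Loop erasure for stars. A shortcut may leave the star of `w` from a vertex other than `w`;
    -- this is harmless, as stars are entered and left at independent vertices.
    join : ∀ {w w′} → Edge G w w′ → w ∉ H → w′ ∉ H → (Grounded (label w) → label w ≡ ℓ₀) →
           (Grounded (label w′) → label w′ ≡ ℓ₀) → Exit (label w′) → Exit (label w)
    join {w} {w′} e w∉H w′∉H free free′ x@(y , ls , y∉H , y∈ℓ , ∉ls , r) with label w ≟ label w′
    ... | yes eq = subst Exit (≡.sym eq) x
    ... | no ne with label w ∈? ls
    ...   | yes i = cut r i free
    ...   | no ∉ = w , label w′ ∷ ls , w∉H , refl , ∉-∷ ne ∉ , via e w′∉H y∉H y∈ℓ free′ ∉ls r

    -- The walk is followed until it meets `H` or a grounded star other than `ℓ₀`, where the ear can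
    -- close. Avoidance of the deleted edge is remembered only for a step into `H`, since only an
    -- ear with a single new vertex could retrace that edge.
    trace : ∀ {w z k} → w ∉ H → Walk (EdgeWithout G a₀ w₀) w z k → z ∈ H →
            (Grounded (label w) → label w ≡ ℓ₀) → Exit (label w)
    trace w∉H here z∈H _ = contradiction z∈H w∉H
    trace {w} w∉H (step {w = w′} e p) z∈H free with w′ ∈? H
    ... | yes w′∈H = w , [] , w∉H , refl , (λ ()) , toH e w′∈H
    ... | no w′∉H with grounded? (label w′) ×-dec ¬? (label w′ ≟ ℓ₀)
    ...   | yes (γ , ≢ℓ₀) = w , label w′ ∷ [] , w∉H , refl ,
            (λ { (here eq) → ≢ℓ₀ (≡.trans (≡.sym eq) (free (subst Grounded (≡.sym eq) γ))) }) ,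
            toG (proj₁ e) w′∉H γ ≢ℓ₀
    ...   | no ¬stop = join (proj₁ e) w∉H w′∉H free free′ (trace w′∉H p z∈H free′)
      where
      free′ : Grounded (label w′) → label w′ ≡ ℓ₀
      free′ γ = decidable-stable (label w′ ≟ ℓ₀) (λ ≢ℓ₀ → ¬stop (γ , ≢ℓ₀))

    EndsBelow : (Fin n → Kind) → ℕ → ∀ {y ls} → Route y ls → Set
    EndsBelow kind e (toH {t = t} _ _)     = ow (kind t) ≤ e
    EndsBelow kind e (toG _ _ _ _)         = ⊤
    EndsBelow kind e (via _ _ _ _ _ _ r) = EndsBelow kind e r

    ends-below-2 : ∀ kind {y ls} (r : Route y ls) → EndsBelow kind 2 r
    ends-below-2 kind (toH {t = t} _ _)     = ow≤2 (kind t)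
    ends-below-2 kind (toG _ _ _ _)         = tt
    ends-below-2 kind (via _ _ _ _ _ _ r) = ends-below-2 kind r

    -- Reversing the oriented part exchanges `iw` and `ow`, one of which is at most 1 at the end.
    -- The route itself is undirected and serves both cases.
    ends-below-1 : ∀ kind {y ls} (r : Route y ls) → EndsBelow kind 1 r ⊎ EndsBelow (flip ∘ kind) 1 r
    ends-below-1 kind (toH {t = t} _ _) with iw≤1⊎ow≤1 (kind t)
    ... | inj₁ i≤1 = inj₂ (subst (_≤ 1) (≡.sym (ow-flip (kind t))) i≤1)
    ... | inj₂ o≤1 = inj₁ o≤1
    ends-below-1 kind (toG _ _ _ _)         = inj₁ tt
    ends-below-1 kind (via _ _ _ _ _ _ r) = ends-below-1 kind r

    -- The ear is built backwards from the end of the route. Since `ℓ₀` is not on it, every star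
    -- passed through is ungrounded, as `cluster` requires.
    route-ear : ∀ kind → (∀ {h} → h ∈ H → h ∈ₛ D → kind h ≡ dom) → ∀ {e} → 1 ≤ e → e ≤ 2 →
                ∀ {y ls} (r : Route y ls) → EndsBelow kind e r → ℓ₀ ∉ ls → Ear kind a₀ w₀ y ls 1 e
    route-ear kind dk {e} 1≤e e≤2 (toH y~t t∈H) o≤e _ = record
      { gs = [] ; t∈H = t∈H ; names = refl ; nondeg = λ _ → y~t ; earned = []
      ; path = path-[] (proj₁ y~t) (s≤s (≤-trans o≤e (m≤m+n e 0))) }
    route-ear kind dk 1≤e e≤2 (toG y~w w∉H γ _) _ _ = ground kind a₀ w₀ dk 1≤e y~w w∉H γ
    route-ear kind dk 1≤e e≤2 (via y~x x∉H y′∉H y′∈ℓ free ∉ls r) below ℓ₀∉ with ungrounded (λ γ → ℓ₀∉ (here (≡.sym (free γ))))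
    ... | ℓ∈D , ¬τ = proj₁ (cluster kind a₀ w₀ e≤2 ℓ∈D ¬τ ∉ls y~x x∉H refl y′∉H y′∈ℓ
                       (route-ear kind dk 1≤e e≤2 r below (ℓ₀∉ ∘ there)))

  -- Ears with both ends in the oriented part.

  record ClosedEar (kind : Fin n → Kind) : Set₁ where
    field
      {s t}  : Fin n
      {a L}  : ℕ
      {ls}   : List (Fin n)
      {wκ}   : Fin n × Kind
      {ws}   : List (Fin n × Kind)
      gs     : List (Fin n × ℕ)
      s∈H    : s ∈ H
      t∈H    : t ∈ H
      iw≤a   : iw (kind s) ≤ a
      path   : Path ls s (wκ ∷ ws) t a (total gs) L (ow (kind t))
      long   : s ≡ t → ws ≢ []
      earned : All (Gains (wκ ∷ ws)) gs
      names  : Unique (map proj₁ gs)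

  close : ∀ kind {s w₀ ℓ ls a e} → s ∈ H → iw (kind s) ≤ a → Unique ls → ℓ ∉ ls →
          (E : Ear kind s w₀ s (ℓ ∷ ls) a e) →
          Opens kind s w₀ E (EdgeWithout G s w₀ w₀ (Ear.t E)) → ClosedEar kind
  close kind s∈H i≤a u ∉ls E (_ , _ , refl , single) = record
    { gs = gs ; s∈H = s∈H ; t∈H = t∈H ; iw≤a = i≤a ; path = path ; earned = earned
    ; names = subst Unique (≡.sym names) (¬Any⇒All¬ _ ∉ls ∷ u)
    -- With `s ≡ t` and one new vertex, the second edge would be the deleted one traversed
    -- backwards.
    ; long = λ { refl ws≡[] → proj₂ (single ws≡[]) (inj₂ (refl , refl)) } }
    where open Ear E

  module _ (kind : Fin n → Kind) (dom-kind : ∀ {h} → h ∈ H → h ∈ₛ D → kind h ≡ dom)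
           (bridgeless : ∀ a b → Edge G a b → AllReach (EdgeWithout G a b)) where

    flip-dom-kind : ∀ {h} → h ∈ H → h ∈ₛ D → flip (kind h) ≡ dom
    flip-dom-kind h∈H h∈D = cong flip (dom-kind h∈H h∈D)

    -- The second alternative is an ear for the reversed orientation of `H`.
    OneOf : ((Fin n → Kind) → Set₁) → Set₁
    OneOf R = R kind ⊎ R (flip ∘ kind)

    orient : ∀ (P : (Fin n → Kind) → Set) {R : (Fin n → Kind) → Set₁} → P kind ⊎ P (flip ∘ kind) →
             (∀ κ → (∀ {h} → h ∈ H → h ∈ₛ D → κ h ≡ dom) → P κ → R κ) → OneOf R
    orient P (inj₁ p) f = inj₁ (f kind dom-kind p)
    orient P (inj₂ p) f = inj₂ (f (flip ∘ kind) flip-dom-kind p)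

    label-lone : ∀ {y} → label y ∉ₛ D → label y ≡ y
    label-lone {y} ℓ∉D with label y | labelled y
    ... | _ | self _          = refl
    ... | _ | lone _ _ _ _    = refl
    ... | _ | under _ d∈D _ _ = contradiction d∈D ℓ∉D

    ear-lone : ∀ {v h} → v ∉ H → v ∉ₛ D → h ∈ₛ D → h ∈ H → Edge G h v → label v ≡ v → OneOf ClosedEar
    ear-lone {v} {h} v∉H v∉D h∈D h∈H h~v v∈v
      with subst (Exit h v v) v∈v (trace h v v v∉H (proj₂ (bridgeless h v h~v v h)) h∈H (λ _ → v∈v))
    -- The label `v` lies outside `D`, so its star is `v` alone and the route leaves from `v`.
    ... | y , ls , y∉H , y∈v , ∉ls , r with ≡.trans (≡.sym (label-lone {y} (subst (_∉ₛ D) (≡.sym y∈v) v∉D))) y∈v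
    ...   | refl = orient (λ κ → EndsBelow h v v κ 1 r) (ends-below-1 h v v kind r) λ κ dk below →
      let E , single = start-lone κ h v dk h∈D h∈H h~v v∉D v∉H v∈v ∉ls
                         (route-ear h v v κ dk ≤-refl (s≤s z≤n) r below ∉ls)
      in close κ h∈H ≤-refl (route-unique h v v r) ∉ls E single

    ear-centre : ∀ {d u} → d ∉ H → d ∈ₛ D → u ∈ H → Edge G u d → OneOf ClosedEar
    ear-centre {d} {u} d∉H d∈D u∈H u~d
      with subst (Exit u d d) (label-self d∈D) (trace u d d d∉H (proj₂ (bridgeless u d u~d d u)) u∈H (λ _ → label-self d∈D))
    ... | y , ls , y∉H , y∈d , ∉ls , r =
      orient (λ κ → EndsBelow u d d κ 1 r) (ends-below-1 u d d kind r) λ κ dk below →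
      let E , single = start-centre κ u d dk u~d d∈D d∉H y∉H y∈d ∉ls
                         (route-ear u d d κ dk ≤-refl (s≤s z≤n) r below ∉ls)
      in close κ u∈H ≤-refl (route-unique u d d r) ∉ls E single

    -- Here `cluster` tolerates excess 2 at the end but charges only 1 at the start, so reversal is
    -- spent on the weight of `a`. In the two cases before, it is spent on the end of the route.
    ear-free : ∀ {a w} → ¬ Grounded (label w) → a ∈ H → w ∉ H → Edge G a w → OneOf ClosedEar
    ear-free {a} {w} ¬γ a∈H w∉H a~w
      with trace a w (label w) w∉H (proj₂ (bridgeless a w a~w w a)) a∈H (λ _ → refl)
    ... | y , ls , y∉H , y∈ℓ , ∉ls , r =
      orient (λ κ → iw (κ a) ≤ 1) below λ κ dk i≤1 →
      let ℓ∈D , ¬τ = ungrounded ¬γ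
          E , o = cluster κ a w ≤-refl ℓ∈D ¬τ ∉ls a~w w∉H refl y∉H y∈ℓ
                    (route-ear a w (label w) κ dk (s≤s z≤n) ≤-refl r (ends-below-2 a w (label w) κ r) ∉ls)
      in close κ a∈H i≤1 (route-unique a w (label w) r) ∉ls E
           (let wκ , ws′ , eq , single = o in wκ , ws′ , eq , λ ws≡[] → open-end (single ws≡[]))
      where
      below : iw (kind a) ≤ 1 ⊎ iw (flip (kind a)) ≤ 1
      below with iw≤1⊎ow≤1 (kind a)
      ... | inj₁ i≤1 = inj₁ i≤1
      ... | inj₂ o≤1 = inj₂ (subst (_≤ 1) (≡.sym (iw-flip (kind a))) o≤1)
      open-end : ∀ {y t} → w ≡ y × EdgeWithout G a w y t → EdgeWithout G a w w t
      open-end (refl , e) = e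

    -- The given edge is exchanged for a better first edge if there is one: a lone vertex is entered
    -- from its dominator, a star with a touched centre at that centre.
    ear : ∀ {a w} → a ∈ H → w ∉ H → Edge G a w → OneOf ClosedEar
    ear {a} {w} a∈H w∉H a~w = go (label w) refl (labelled w)
      where
      go : ∀ ℓ → label w ≡ ℓ → Label w ℓ → OneOf ClosedEar
      go ℓ _   (self w∈D)             = ear-centre w∉H w∈D a∈H a~w
      go ℓ w∈w (lone w∉D h∈D h∈H h~w) = ear-lone w∉H w∉D h∈D h∈H h~w w∈w
      go ℓ w∈ℓ (under _ ℓ∈D ℓ∉H _) with touches? H ℓ
      ... | yes τ = let (u , u∈H , u~ℓ) = find τ in ear-centre ℓ∉H ℓ∈D u∈H u~ℓ
      ... | no ¬τ = ear-free (λ γ → ungrounded-by (subst Grounded w∈ℓ γ)) a∈H w∉H a~w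
        where
        ungrounded-by : ¬ Grounded ℓ
        ungrounded-by (inj₁ ℓ∉D) = ℓ∉D ℓ∈D
        ungrounded-by (inj₂ τ)   = ¬τ τ

-- Arcs of an ear and updates of kinds.

module _ {n : ℕ} where

  arcs : Fin n → List (Fin n × Kind) → Fin n → List (Fin n × Fin n)
  arcs p []             t = (p , t) ∷ []
  arcs p ((w , _) ∷ ws) t = (p , w) ∷ arcs w ws t

  arcs⇒Links : ∀ {R : Fin n → Fin n → Set} p ws t → (∀ {u v} → (u , v) ∈ arcs p ws t → R u v) → Links R p ws t
  arcs⇒Links p []             t f = f (here refl)
  arcs⇒Links p ((w , _) ∷ ws) t f = f (here refl) , arcs⇒Links w ws t (f ∘ there)

  Links⇒arcs : ∀ {R : Fin n → Fin n → Set} p ws t → Links R p ws t → ∀ {u v} → (u , v) ∈ arcs p ws t → R u v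
  Links⇒arcs p []             t r        (here refl) = r
  Links⇒arcs p ((w , _) ∷ ws) t (r , _)  (here refl) = r
  Links⇒arcs p ((w , _) ∷ ws) t (_ , rs) (there i)   = Links⇒arcs w ws t rs i

  arcs-source : ∀ p ws t {u v} → (u , v) ∈ arcs p ws t → u ∈ p ∷ map proj₁ ws
  arcs-source p []             t (here refl) = here refl
  arcs-source p ((w , _) ∷ ws) t (here refl) = here refl
  arcs-source p ((w , _) ∷ ws) t (there i)   = there (arcs-source w ws t i)

  arcs-target : ∀ p ws t {u v} → (u , v) ∈ arcs p ws t → v ∈ t ∷ map proj₁ ws
  arcs-target p []             t (here refl) = here refl
  arcs-target p ((w , _) ∷ ws) t (here refl) = there (here refl)
  arcs-target p ((w , _) ∷ ws) t (there i) with arcs-target w ws t i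
  ... | here e  = here e
  ... | there j = there (there j)

  -- Inner vertices are distinct and differ from the ends, so two opposite arcs can occur only if
  -- the ends coincide and there is at most one inner vertex.
  arcs-asym : ∀ p ws t → p ∉ map proj₁ ws → t ∉ map proj₁ ws → Unique (map proj₁ ws) →
              (p ≡ t → 2 ≤ length ws) → ∀ {u v} → (u , v) ∈ arcs p ws t → (v , u) ∉ arcs p ws t
  arcs-asym p [] t _ _ _ long (here refl) (here refl) = contradiction (long refl) λ ()
  arcs-asym p ((w , _) ∷ ws) t p∉ t∉ (w≢ ∷ u) long = go
    where
    opposite : (w , p) ∉ arcs w ws t
    opposite i with arcs-target w ws t i
    ... | there j    = p∉ (there j)
    ... | here refl = last ws (long refl) w≢ (t∉ ∘ there) i
      where
      last : ∀ ws → 2 ≤ suc (length ws) → All (w ≢_) (map proj₁ ws) → t ∉ map proj₁ ws → (w , t) ∉ arcs w ws t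
      last [] (s≤s ())
      last ((x , _) ∷ ws) _ w≢ t∉ (here refl) = t∉ (here refl)
      last ((x , _) ∷ ws) _ w≢ t∉ (there i)   = All¬⇒¬Any w≢ (arcs-source x ws t i)
    go : ∀ {u v} → (u , v) ∈ (p , w) ∷ arcs w ws t → (v , u) ∉ (p , w) ∷ arcs w ws t
    go (here refl) (here refl) = p∉ (here refl)
    go (here refl) (there j)   = opposite j
    go (there i)   (here refl) = opposite i
    go (there i)   (there j)   = arcs-asym w ws t (All¬⇒¬Any w≢) (t∉ ∘ there) u
                                   (λ { refl → contradiction (here refl) t∉ }) i j

  assign : List (Fin n × Kind) → (Fin n → Kind) → Fin n → Kind
  assign []             f v = f v
  assign ((w , κ) ∷ ws) f v with v ≟ w
  ... | yes _ = κ
  ... | no _  = assign ws f v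

  assign-∉ : ∀ ws f {v} → v ∉ map proj₁ ws → assign ws f v ≡ f v
  assign-∉ []             f v∉ = refl
  assign-∉ ((w , κ) ∷ ws) f {v} v∉ with v ≟ w
  ... | yes e = contradiction (here e) v∉
  ... | no _  = assign-∉ ws f (v∉ ∘ there)

  assign-∈ : ∀ ws f {v κ} → Unique (map proj₁ ws) → (v , κ) ∈ ws → assign ws f v ≡ κ
  assign-∈ ((w , κ) ∷ ws) f {v} (w≢ ∷ u) (here refl) with v ≟ v
  ... | yes _ = refl
  ... | no v≢v = contradiction refl v≢v
  assign-∈ ((w , κ) ∷ ws) f {v} (w≢ ∷ u) (there i) with v ≟ w
  ... | yes refl = contradiction (∈-map⁺ proj₁ i) (All¬⇒¬Any w≢)
  ... | no _     = assign-∈ ws f u i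

-- The distance invariant.

module Growth {n : ℕ} (G : Graph n) (D : Subset n) (dominating : Dominating G D) where

  open Data.List.Membership.DecPropositional (_≟_ {n}) using (_∈?_)
  open Potential G D

  -- `dist` bounds distances by `Φ H` minus 4 plus the weights, with the 4 moved across to avoid
  -- subtraction. Edges inside `H` may still be undirected, as later arcs only shorten distances.
  record State (H : List (Fin n)) : Set₁ where
    field
      Arrow    : Fin n → Fin n → Set
      arrow?   : Decidable Arrow
      kind     : Fin n → Kind
      is-edge  : ∀ {u v} → Arrow u v → Edge G u v
      inside-H : ∀ {u v} → Arrow u v → u ∈ H × v ∈ H
      asym     : ∀ {u v} → Arrow u v → ¬ Arrow v u
      dom-kind : ∀ {h} → h ∈ H → h ∈ₛ D → kind h ≡ dom
      4≤Φ      : 4 ≤ Φ H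
      dist     : ∀ {u v} → u ∈ H → v ∈ H →
                 ∃ λ k → Walk Arrow u v k × k + 4 ≤ Φ H + ow (kind u) + iw (kind v)

  reversed : ∀ {H} → State H → State H
  reversed {H} S = record
    { Arrow = λ u v → Arrow v u ; arrow? = λ u v → arrow? v u ; kind = flip ∘ kind
    ; is-edge = symE ∘ is-edge ; inside-H = λ a → let (x , y) = inside-H a in y , x ; asym = asym
    ; dom-kind = λ h∈H h∈D → cong flip (dom-kind h∈H h∈D) ; 4≤Φ = 4≤Φ ; dist = dist′ }
    where
    open State S
    dist′ : ∀ {u v} → u ∈ H → v ∈ H → ∃ λ k → Walk (λ u v → Arrow v u) u v k ×
            k + 4 ≤ Φ H + ow (flip (kind u)) + iw (flip (kind v))
    dist′ {u} {v} u∈H v∈H with dist v∈H u∈H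
    ... | k , p , k≤ rewrite ow-flip (kind u) | iw-flip (kind v) =
      k , walk-reverse (λ a → a) p , ≤-trans k≤ (≤-reflexive (eq (Φ H) (ow (kind v)) (iw (kind u))))
      where
      eq : ∀ a b c → a + b + c ≡ a + c + b
      eq = solve-∀

  module _ {H : List (Fin n)} (S : State H) where

    open State S
    open Ears G D dominating H using (module ClosedEar; ClosedEar; module Path; module Gains)

    -- Extension by an ear.

    module _ (C : ClosedEar kind) where

      open ClosedEar C renaming (ws to ws₀)
      ws : List (Fin n × Kind)
      ws = wκ ∷ ws₀
      open Path path

      H′ : List (Fin n)
      H′ = map proj₁ ws ++ H

      private
        g : ℕ
        g = total gs

        kind′ : Fin n → Kind
        kind′ = assign ws kind

        Arrow′ : Fin n → Fin n → Set
        Arrow′ u v = Arrow u v ⊎ (u , v) ∈ arcs s ws t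

        arrow′? : Decidable Arrow′
        arrow′? u v = arrow? u v ⊎-dec (u , v) ∈?₂ arcs s ws t
          where open Data.List.Membership.DecPropositional (≡-dec (_≟_ {n}) (_≟_ {n})) renaming (_∈?_ to _∈?₂_)

        new∉H : ∀ {w} → w ∈ map proj₁ ws → w ∉ H
        new∉H i with ∈-map⁻ proj₁ i
        ... | _ , j , refl = proj₁ (All.lookup fresh j)

        new : ∀ {w} → w ∈ map proj₁ ws → w ∈ H′
        new = ∈-++⁺ˡ

        old : ∀ {w} → w ∈ H → w ∈ H′
        old = ∈-++⁺ʳ (map proj₁ ws)

        arcs-in : ∀ {u v} → (u , v) ∈ arcs s ws t → u ∈ H′ × v ∈ H′
        arcs-in i = source (arcs-source s ws t i) , target (arcs-target s ws t i)
          where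
          source : ∀ {u} → u ∈ s ∷ map proj₁ ws → u ∈ H′
          source (here refl) = old s∈H
          source (there i)   = new i
          target : ∀ {u} → u ∈ t ∷ map proj₁ ws → u ∈ H′
          target (here refl) = old t∈H
          target (there i)   = new i

        -- Only the first arc starts in `H`, and it ends at a new vertex. Hence no arc of the ear
        -- opposes an old arrow.
        arcs-leave : ∀ {u v} → (u , v) ∈ arcs s ws t → u ∈ H → v ∉ H
        arcs-leave (here refl) _ = new∉H (here refl)
        arcs-leave (there i) u∈H _ = new∉H (arcs-source _ ws₀ t i) u∈H

        asym′ : ∀ {u v} → Arrow′ u v → ¬ Arrow′ v u
        asym′ (inj₁ a) (inj₁ b) = asym a b
        asym′ (inj₁ a) (inj₂ b) = let (u∈H , v∈H) = inside-H a in arcs-leave b v∈H u∈H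
        asym′ (inj₂ a) (inj₁ b) = let (v∈H , u∈H) = inside-H b in arcs-leave a u∈H v∈H
        asym′ (inj₂ a) (inj₂ b) = arcs-asym s ws t (λ i → new∉H i s∈H) (λ i → new∉H i t∈H) unique
                                    (λ s≡t → s≤s (nonempty ws₀ (long s≡t))) a b
          where
          nonempty : ∀ (ws : List (Fin n × Kind)) → ws ≢ [] → 1 ≤ length ws
          nonempty []      h = contradiction refl h
          nonempty (_ ∷ _) h = s≤s z≤n

        Φ-gain : Φ H + g ≤ Φ H′
        Φ-gain = sum-gains (φ H) (φ H′) gs names (φ-mono old)
          (All.map (λ γ → Gains.gained γ H′ (λ _ → old) (λ _ → new)) earned)

        data Place (u : Fin n) : Set where
          was : u ∈ H → kind′ u ≡ kind u → Place u
          is  : ∀ {κ} → (u , κ) ∈ ws → kind′ u ≡ κ → Place u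

        place : ∀ {u} → u ∈ H′ → Place u
        place {u} i with ∈-++⁻ (map proj₁ ws) i
        ... | inj₂ u∈H = was u∈H (assign-∉ ws kind (λ j → new∉H j u∈H))
        ... | inj₁ j with ∈-map⁻ proj₁ j
        ...   | (_ , κ) , l , refl = is l (assign-∈ ws kind unique l)

        dom-kind′ : ∀ {h} → h ∈ H′ → h ∈ₛ D → kind′ h ≡ dom
        dom-kind′ i h∈D with place i
        ... | was h∈H e = ≡.trans e (dom-kind h∈H h∈D)
        ... | is j e    = ≡.trans e (All.lookup doms j h∈D)

        open Bounds (bounds (arcs⇒Links {R = Arrow′} s ws t inj₂))

        Near : Fin n → Fin n → Kind → Kind → Set
        Near u v κ κ′ = ∃ λ k → Walk Arrow′ u v k × k + 4 ≤ Φ H′ + ow κ + iw κ′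

        lift : ∀ {u v k} → Walk Arrow u v k → Walk Arrow′ u v k
        lift = walk-map inj₁

        old-old : ∀ {u v} → u ∈ H → v ∈ H → Near u v (kind u) (kind v)
        old-old {u} {v} u∈H v∈H with dist u∈H v∈H
        ... | k , p , k≤ = k , lift p , ≤-trans k≤
          (+-monoˡ-≤ (iw (kind v)) (+-monoˡ-≤ (ow (kind u)) (≤-trans (m≤m+n (Φ H) g) Φ-gain)))

        old-new : ∀ {u v κ} → u ∈ H → (v , κ) ∈ ws → Near u v (kind u) κ
        old-new {u} {v} {κ} u∈H i with dist u∈H s∈H | enter i
        ... | j , p , j≤ | k , q , k≤ = j + k , lift p ▷ q ,
          certify (j≤ ⊞ k≤ ⊞ iw≤a ⊞ Φ-gain) (eq j k a g (Φ H) (Φ H′) (ow (kind u)) (iw (kind s)) (iw κ))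
          where
          eq : ∀ j k a g Φ Φ′ o i i′ → j + k + 4 + (Φ + o + i + (g + i′) + a + Φ′) ≡ Φ′ + o + i′ + (j + 4 + (k + a) + i + (Φ + g))
          eq = solve-∀

        new-old : ∀ {u v κ} → (u , κ) ∈ ws → v ∈ H → Near u v κ (kind v)
        new-old {u} {v} {κ} i v∈H with leave i | dist t∈H v∈H
        ... | k , q , k≤ | j , p , j≤ = k + j , q ▷ lift p ,
          certify (j≤ ⊞ k≤ ⊞ Φ-gain) (eq j k g (Φ H) (Φ H′) (ow κ) (ow (kind t)) (iw (kind v)))
          where
          eq : ∀ j k g Φ Φ′ o o′ i → k + j + 4 + (Φ + o′ + i + (g + o) + Φ′) ≡ Φ′ + o + i + (j + 4 + (k + o′) + (Φ + g))
          eq = solve-∀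

        new-new : ∀ {u v κ κ′} → (u , κ) ∈ ws → (v , κ′) ∈ ws → Near u v κ κ′
        new-new {κ = κ} {κ′} i j with order i j
        -- Even distance 0 needs a potential of at least 4.
        ... | inj₁ refl = 0 , here , ≤-trans 4≤Φ (≤-trans (m≤m+n (Φ H) g) (≤-trans Φ-gain
                            (≤-trans (m≤m+n (Φ H′) (ow κ)) (m≤m+n _ (iw κ′)))))
        ... | inj₂ (inj₁ (before {kₘ = m} p m≤ _ _ _)) = m , p ,
          certify (m≤ ⊞ 4≤Φ ⊞ Φ-gain) (eq m g (Φ H) (Φ H′) (ow κ) (iw κ′))
          where
          eq : ∀ m g Φ Φ′ o i → m + 4 + (g + o + i + Φ + Φ′) ≡ Φ′ + o + i + (m + 4 + (Φ + g))
          eq = solve-∀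
        ... | inj₂ (inj₂ (before {kᵢ} {kₒ} _ _ p q around)) with dist t∈H s∈H
        ...   | l , r , l≤ = kₒ + (l + kᵢ) , q ▷ lift r ▷ p ,
          certify (around ⊞ l≤ ⊞ iw≤a ⊞ Φ-gain) (eq kᵢ kₒ l a g (Φ H) (Φ H′) (ow κ) (ow (kind t)) (iw κ′) (iw (kind s)))
          where
          eq : ∀ k k′ l a g Φ Φ′ o o′ i i′ → k′ + (l + k) + 4 + (g + i + o + (Φ + o′ + i′) + a + Φ′) ≡
                 Φ′ + o + i + (k + k′ + a + o′ + (l + 4) + i′ + (Φ + g))
          eq = solve-∀

        dist′ : ∀ {u v} → u ∈ H′ → v ∈ H′ → Near u v (kind′ u) (kind′ v)
        dist′ {u} {v} i j with place i | place j
        ... | was x e | was y e′ rewrite e | e′ = old-old x y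
        ... | was x e | is y e′  rewrite e | e′ = old-new x y
        ... | is x e  | was y e′ rewrite e | e′ = new-old x y
        ... | is x e  | is y e′  rewrite e | e′ = new-new x y

      extend : State H′
      extend = record
        { Arrow = Arrow′ ; arrow? = arrow′? ; kind = kind′
        ; is-edge = λ { (inj₁ a) → is-edge a ; (inj₂ a) → Links⇒arcs s ws t edges a }
        ; inside-H = λ { (inj₁ a) → let (x , y) = inside-H a in old x , old y ; (inj₂ a) → arcs-in a }
        ; asym = asym′ ; dom-kind = dom-kind′
        ; 4≤Φ = ≤-trans 4≤Φ (≤-trans (m≤m+n (Φ H) g) Φ-gain) ; dist = dist′ }

  -- Growth until every vertex is covered.

  missing : List (Fin n) → Fin n → ℕ
  missing H v with v ∈? H
  ... | yes _ = 0
  ... | no _  = 1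

  missing-in : ∀ {H v} → v ∈ H → missing H v ≡ 0
  missing-in {H} {v} v∈H with v ∈? H
  ... | yes _  = refl
  ... | no v∉H = contradiction v∈H v∉H

  missing-mono : ∀ {H H′} → (∀ {v} → v ∈ H → v ∈ H′) → ∀ v → missing H′ v ≤ missing H v
  missing-mono {H} {H′} H⊆ v with v ∈? H | v ∈? H′
  ... | yes v∈H | yes _   = z≤n
  ... | yes v∈H | no v∉H′ = contradiction (H⊆ v∈H) v∉H′
  ... | no _    | yes _   = z≤n
  ... | no _    | no _    = ≤-refl

  missing-out : ∀ {H v} → v ∉ H → missing H v ≡ 1
  missing-out {H} {v} v∉H with v ∈? H
  ... | yes v∈H = contradiction v∈H v∉H
  ... | no _    = refl

  deficit : List (Fin n) → ℕ
  deficit H = sum (missing H)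

  -- `sum-gains` is applied in the opposite direction: passing from `H′` back to `H` gains one at
  -- `w`.
  deficit-< : ∀ {H H′ w} → (∀ {v} → v ∈ H → v ∈ H′) → w ∉ H → w ∈ H′ → deficit H′ < deficit H
  deficit-< {H} {H′} {w} H⊆ w∉H w∈H′ = ≤-trans (≤-reflexive (≡.sym (+-comm (deficit H′) 1)))
    (sum-gains (missing H′) (missing H) ((w , 1) ∷ []) ([] ∷ []) (missing-mono H⊆)
      (≤-reflexive (≡.trans (cong (_+ 1) (missing-in w∈H′)) (≡.sym (missing-out w∉H))) ∷ []))

  exit-edge : ∀ {H x v k} → Walk (Edge G) x v k → x ∈ H → v ∉ H → ∃₂ λ a w → a ∈ H × w ∉ H × Edge G a w
  exit-edge here x∈H v∉H = contradiction x∈H v∉H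
  exit-edge {H} (step {w = w} e p) x∈H v∉H with w ∈? H
  ... | yes w∈H = exit-edge p w∈H v∉H
  ... | no w∉H  = _ , _ , x∈H , w∉H , e

  module _ (connected : Connected G) (bridgeless : ∀ a b → Edge G a b → AllReach (EdgeWithout G a b)) where

    Larger : List (Fin n) → Set₁
    Larger H = ∃ λ H′ → State H′ × (∀ {v} → v ∈ H → v ∈ H′) × deficit H′ < deficit H

    larger : ∀ {H} (S : State H) → Ears.ClosedEar G D dominating H (State.kind S) → Larger H
    larger {H} S C = H′ S C , extend S C , old , deficit-< old (proj₁ (All.lookup fresh (here refl))) (here refl)
      where
      open Ears.Path (Ears.ClosedEar.path C) using (fresh)
      old : ∀ {v} → v ∈ H → v ∈ H′ S C
      old = ∈-++⁺ʳ (map proj₁ (ws S C))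

    enlarge : ∀ {H a w} → State H → a ∈ H → w ∉ H → Edge G a w → Larger H
    enlarge {H} S a∈H w∉H e
      with Ears.ear G D dominating H (State.kind S) (State.dom-kind S) bridgeless a∈H w∉H e
    ... | inj₁ C = larger S C
    ... | inj₂ C = larger (reversed S) C

    saturate : ∀ {r H} → State H → r ∈ H → Acc _<_ (deficit H) → ∃ λ H′ → State H′ × (∀ v → v ∈ H′)
    saturate {r} {H} S r∈H (acc rec) with all? (_∈? H)
    ... | yes full = H , S , full
    ... | no ¬full with ¬∀⟶∃¬ n (_∈ H) (_∈? H) ¬full
    ...   | v , v∉H with exit-edge (proj₂ (connected r v)) r∈H v∉H
    ...     | a , w , a∈H , w∉H , e with enlarge S a∈H w∉H e
    ...       | H′ , S′ , H⊆ , fewer = saturate S′ (H⊆ r∈H) (rec fewer)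

    single : ∀ {r} → r ∈ₛ D → State (r ∷ [])
    single {r} r∈D = record
      { Arrow = λ _ _ → ⊥ ; arrow? = λ _ _ → no λ () ; kind = λ _ → dom
      ; is-edge = λ () ; inside-H = λ () ; asym = λ () ; dom-kind = λ _ _ → refl ; 4≤Φ = 4≤Φ
      ; dist = λ { (here refl) (here refl) → 0 , here , ≤-trans 4≤Φ (≤-trans (m≤m+n _ 0) (m≤m+n _ 0)) } }
      where
      4≤Φ : 4 ≤ Φ (r ∷ [])
      -- `Φ` is compared with the zero function raised by 4 at `r`.
      4≤Φ = ≤-trans (m≤n+m 4 (sum (λ (_ : Fin n) → 0)))
        (sum-gains (λ _ → 0) (φ (r ∷ [])) ((r , 4) ∷ []) ([] ∷ []) (λ _ → z≤n)
          (≤-reflexive (≡.sym (φ-in r∈D (here refl))) ∷ []))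

    saturated : Fin n → ∃ λ H → State H × (∀ v → v ∈ H)
    saturated v with v ∈ₛ? D
    ... | yes v∈D = saturate (single v∈D) (here refl) (<-wellFounded _)
    ... | no v∉D  = saturate (single (proj₁ (proj₂ (dominating v v∉D)))) (here refl) (<-wellFounded _)

  does⁻ : ∀ {P : Set} (P? : Dec P) → does P? ≡ true → P
  does⁻ (yes p) _ = p

  -- The final orientation and its diameter.

  module _ {H : List (Fin n)} (S : State H) (full : ∀ v → v ∈ H) where

    open State S

    -- Edges that no ear has used are directed towards the larger index, which keeps all the walks
    -- found so far.
    Oriented : Fin n → Fin n → Set
    Oriented u v = Arrow u v ⊎ (Edge G u v × ¬ Arrow v u × u Fin.< v)

    oriented? : Decidable Oriented
    oriented? u v = arrow? u v ⊎-dec ((adj G u v ≟ᵇ true) ×-dec ¬? (arrow? v u) ×-dec u <? v)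

    oriented-asym : ∀ {u v} → Oriented u v → ¬ Oriented v u
    oriented-asym (inj₁ a)            (inj₁ b)            = asym a b
    oriented-asym (inj₁ a)            (inj₂ (_ , ¬a , _)) = ¬a a
    oriented-asym (inj₂ (_ , ¬b , _)) (inj₁ b)            = ¬b b
    oriented-asym (inj₂ (_ , _ , u<v)) (inj₂ (_ , _ , v<u)) = <-asym u<v v<u

    oriented-edge : ∀ {u v} → Oriented u v → Edge G u v
    oriented-edge (inj₁ a)           = is-edge a
    oriented-edge (inj₂ (e , _ , _)) = e

    oriented-total : ∀ u v → Edge G u v → Oriented u v ⊎ Oriented v u
    oriented-total u v e with arrow? u v | arrow? v u | <-cmp u v
    ... | yes a | _     | _              = inj₁ (inj₁ a)
    ... | no _  | yes b | _              = inj₂ (inj₁ b)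
    ... | no _  | no ¬b | tri< u<v _ _   = inj₁ (inj₂ (e , ¬b , u<v))
    ... | no ¬a | no _  | tri> _ _ v<u   = inj₂ (inj₂ (symE e , ¬a , v<u))
    ... | no _  | no _  | tri≈ _ refl _ = contradiction (≡.trans (≡.sym e) (irref G u)) λ ()

    orientation : Orientation G
    orientation = record
      { arc      = λ u v → does (oriented? u v)
      ; arc⇒edge = λ u v → oriented-edge ∘ does⁻ (oriented? u v)
      ; edge⇒arc = λ u v e → Sum.map (dec-true (oriented? u v)) (dec-true (oriented? v u)) (oriented-total u v e)
      ; one-dir  = λ u v → dec-false (oriented? v u) ∘ oriented-asym ∘ does⁻ (oriented? u v) }

    orientation-diam : DiamAtMost orientation (4 * ∣ D ∣)
    orientation-diam u v with dist (full u) (full v)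
    -- The two weights, at most 2 each, cancel the 4 of the invariant and leave `k ≤ Φ H`.
    ... | k , p , k≤ = k , ≤-trans (certify (k≤ ⊞ ow≤2 (kind u) ⊞ iw≤2 (kind v)) (eq k (Φ H) (ow (kind u)) (iw (kind v))))
                             (sum≤4*∣D∣ D (φ H) (λ _ → φ-∉D {H}) (φ≤4 H)) ,
                       walk-map (λ {x} {y} a → dec-true (oriented? x y) (inj₁ a)) p
      where
      eq : ∀ k Φ o i → k + (Φ + o + i + 2 + 2) ≡ Φ + (k + 4 + o + i)
      eq = solve-∀

theorem2 : ∀ (n : ℕ) (G : Graph n) → BridgelessConnected G →
    ∀ (D : Subset n) → Dominating G D →
    Σ (Orientation G) (λ O → StronglyConnected O × DiamAtMost O (4 * ∣ D ∣))
theorem2 zero G _ D _ = record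
  { arc = λ () ; arc⇒edge = λ () ; edge⇒arc = λ () ; one-dir = λ () } , (λ ()) , (λ ())
theorem2 (suc n) G (connected , bridgeless) D dominating =
  let H , S , full = saturated connected bridgeless zero
      diam = orientation-diam S full
  in orientation S full , (λ u v → let k , _ , p = diam u v in k , p) , diam
  where open Growth G D dominating
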